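{- Let $\delta$ be a positive integer and let $$p_\delta(x)=\left(\frac{1+\sqrt{1-4x}}{2}\right)^{\delta+1}+\left(\frac{1-\sqrt{1-4x}}{2}\right)^{\delta+1}.$$ Then $p_\delta(x)$ is a polynomial in $x$ with constant term $1$; writing $p_\delta(x)=\sum_{i=0}^{d}c_ix^i$ with $d=\deg p_\delta$, the sequence $\zeta(\cdot,\delta)$ satisfies the linear recurrence $$\sum_{i=0}^{d}c_i\,\zeta(m-2i,\delta)=0,\quad\text{i.e.}\quad \zeta(m,\delta)=-\sum_{i=1}^{d}c_i\,\zeta(m-2i,\delta),$$ for every integer $m\ge 2d+1$. In other words, $p_\delta$ is the (reciprocal-form) characteristic polynomial of the step-$2$ linear recurrence satisfied by $\zeta(m,\delta)$.
   Context: For positive integers $m$ and $\delta$, a $\delta$-deviation set of size $m$ is a finite sequence $(\alpha_1,\dots,\alpha_\ell)$ of positive integers such that (i) $\sum_i\alpha_i=m$; (ii) $\big|\sum_i\alpha_{2i-1}-\sum_i\alpha_{2i}\big|\le 1$; (iii) $\big|\sum_{1\le i\le j}(-1)^{i-1}\alpha_i\big|\le\delta$ for every $j\ge1$; and $\zeta(m,\delta)$ is the number of $\delta$-deviation sets of size $m$. (Example: $p_3(x)=1-4x+2x^2$ corresponds to $\zeta(m,3)=4\zeta(m-2,3)-2\zeta(m-4,3)$.) -}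

module Defs where

open import Algebra.Bundles using (module CommutativeRing)
import Algebra.Properties.Semiring.Sum as Sum
open import Data.Empty using (⊥)
open import Data.Fin.Base using (Fin; toℕ; inject₁)
import Data.Fin.Permutation as Perm
import Data.Fin.Properties as Fin
open import Data.Integer.Base as ℤ using (ℤ; +_; ∣_∣)
import Data.Integer.Properties as ℤ
open import Data.List.Base using (List; []; _∷_; _++_; map; take; length; filter)
open import Data.List.Membership.Propositional using (_∈_)
open import Data.List.Membership.Propositional.Properties using (∈-++⁺ˡ; ∈-++⁺ʳ; ∈-++⁻; ∈-map⁺; ∈-map⁻; ∈-filter⁺; ∈-filter⁻)
open import Data.List.Properties using (take-all)
open import Data.List.Relation.Unary.All as All using (All; []; _∷_; all?)
open import Data.List.Relation.Unary.Any using (here; there)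
open import Data.List.Relation.Unary.AllPairs using ([]; _∷_)
open import Data.List.Relation.Unary.Unique.Propositional using (Unique)
import Data.List.Relation.Unary.Unique.Propositional.Properties as Unique
open import Data.Nat.Base as ℕ using (ℕ; zero; suc; _≤_; _<_; z≤n; s≤s; ∣_-_∣)
open import Data.Nat.ListAction using (sum)
import Data.Nat.Properties as ℕ
open import Data.Product.Base using (_×_; _,_; proj₁; proj₂)
open import Data.Rational.Base as ℚ using (ℚ; 0ℚ; 1ℚ; ½; _/_)
import Data.Rational.Properties as ℚ
open import Data.Rational.Solver using (module +-*-Solver)
import Data.Rational.Unnormalised.Base as ℚᵘ
import Data.Rational.Unnormalised.Properties as ℚᵘ
open import Data.Sum.Base using (inj₁; inj₂)
open import Function.Base using (_∘_)
open import Function.Bundles using (_⇔_; mk⇔)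
open import Relation.Binary.PropositionalEquality using (_≡_; _≢_; refl; sym; trans; cong; cong₂; subst)
open import Relation.Binary.PropositionalEquality using (module ≡-Reasoning)
open import Relation.Nullary using (Dec; yes; no; contradiction)
open import Relation.Nullary.Decidable using (map′; _×-dec_)

open Sum (CommutativeRing.semiring ℚ.+-*-commutativeRing) public
  using (sum-syntax; sum⁺-syntax)
open Sum (CommutativeRing.semiring ℚ.+-*-commutativeRing)
  using (sum-cong-≗; ∑-distrib-+; ∑-permute; *-distribˡ-sum)

mutual

  -- α₁ , α₃ , α₅ , …
  odds : List ℕ → List ℕ
  odds []      = []
  odds (a ∷ α) = a ∷ evens α

  -- α₂ , α₄ , α₆ , …
  evens : List ℕ → List ℕ
  evens []      = []
  evens (_ ∷ α) = odds α

-- α₁ - α₂ + α₃ - …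
altSum : List ℕ → ℤ
altSum []      = + 0
altSum (a ∷ α) = + a ℤ.- altSum α

-- `take j α` is all of α once j exceeds the length, matching the convention
-- that absent terms contribute nothing to the j-th partial sum.
record IsDeviationSet (m δ : ℕ) (α : List ℕ) : Set where
  constructor mkDeviationSet
  field
    positive : All (0 <_) α
    size     : sum α ≡ m
    balanced : ∣ sum (odds α) - sum (evens α) ∣ ≤ 1
    bounded  : ∀ j → 1 ≤ j → ∣ altSum (take j α) ∣ ≤ δ

bounded? : ∀ δ α → Dec (∀ j → 1 ≤ j → ∣ altSum (take j α) ∣ ≤ δ)
bounded? δ α = map′ to (λ f {j} _ → from f j)
  (ℕ.allUpTo? (λ j → ∣ altSum (take j α) ∣ ℕ.≤? δ) (suc (length α)))
  where
  to : (∀ {j} → j < suc (length α) → ∣ altSum (take j α) ∣ ≤ δ) →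
       ∀ j → 1 ≤ j → ∣ altSum (take j α) ∣ ≤ δ
  to f j _ with j ℕ.≤? length α
  ... | yes j≤ℓ = f (s≤s j≤ℓ)
  ... | no  j≰ℓ = subst (λ β → ∣ altSum β ∣ ≤ δ)
    (trans (take-all (length α) α ℕ.≤-refl) (sym (take-all j α (ℕ.<⇒≤ (ℕ.≰⇒> j≰ℓ)))))
    (f ℕ.≤-refl)

  from : (∀ j → 1 ≤ j → ∣ altSum (take j α) ∣ ≤ δ) →
         ∀ j → ∣ altSum (take j α) ∣ ≤ δ
  from f zero    = z≤n
  from f (suc j) = f (suc j) (s≤s z≤n)

isDeviationSet? : ∀ m δ α → Dec (IsDeviationSet m δ α)
isDeviationSet? m δ α =
  map′ (λ (p , s , b , c) → mkDeviationSet p s b c)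
       (λ (mkDeviationSet p s b c) → p , s , b , c)
       (all? (0 ℕ.<?_) α
         ×-dec sum α ℕ.≟ m
         ×-dec ∣ sum (odds α) - sum (evens α) ∣ ℕ.≤? 1
         ×-dec bounded? δ α)

incHead : List ℕ → List ℕ
incHead []      = []
incHead (a ∷ α) = suc a ∷ α

-- All finite sequences of positive integers with sum m: for m ≥ 2, either
-- the first term is 1, or it comes from incrementing a smaller first term.
compositions : ℕ → List (List ℕ)
compositions zero          = [] ∷ []
compositions (suc zero)    = (1 ∷ []) ∷ []
compositions (suc (suc m)) =
  map (1 ∷_) (compositions (suc m)) ++ map incHead (compositions (suc m))

deviationSets : ℕ → ℕ → List (List ℕ)
deviationSets m δ = filter (isDeviationSet? m δ) (compositions m)

ζ : ℕ → ℕ → ℕ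
ζ m δ = length (deviationSets m δ)

-- ζ m δ is indeed the number of deviation sets: `deviationSets m δ` lists
-- each of them exactly once.

∈-compositions⁺ : ∀ α → All (0 <_) α → α ∈ compositions (sum α)
∈-compositions⁺ []                          []            = here refl
∈-compositions⁺ (suc zero ∷ zero ∷ _)       (_ ∷ () ∷ _)
∈-compositions⁺ (suc zero ∷ [])             (_ ∷ [])      = here refl
∈-compositions⁺ (suc zero ∷ α@(suc _ ∷ _))  (_ ∷ p)       =
  ∈-++⁺ˡ (∈-map⁺ (1 ∷_) (∈-compositions⁺ α p))
∈-compositions⁺ (suc (suc a) ∷ α)           (_ ∷ p)       =
  ∈-++⁺ʳ (map (1 ∷_) (compositions (suc a ℕ.+ sum α)))
    (∈-map⁺ incHead (∈-compositions⁺ (suc a ∷ α) (s≤s z≤n ∷ p)))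

∈-compositions⁻ : ∀ m {α} → α ∈ compositions m → All (0 <_) α
∈-compositions⁻ zero          (here refl) = []
∈-compositions⁻ (suc zero)    (here refl) = s≤s z≤n ∷ []
∈-compositions⁻ (suc (suc m)) α∈ with ∈-++⁻ (map (1 ∷_) (compositions (suc m))) α∈
... | inj₁ α∈₁ with _ , β∈ , refl ← ∈-map⁻ (1 ∷_) α∈₁ =
  s≤s z≤n ∷ ∈-compositions⁻ (suc m) β∈
... | inj₂ α∈₂ with ∈-map⁻ incHead α∈₂
...   | []    , β∈ , refl = []
...   | _ ∷ _ , β∈ , refl = s≤s z≤n ∷ All.tail (∈-compositions⁻ (suc m) β∈)

compositions-unique : ∀ m → Unique (compositions m)
compositions-unique zero          = [] ∷ []
compositions-unique (suc zero)    = [] ∷ []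
compositions-unique (suc (suc m)) = Unique.++⁺
  (Unique.map⁺ (λ { refl → refl }) (compositions-unique (suc m)))
  (Unique.map⁺ incHead-injective (compositions-unique (suc m)))
  disjoint
  where
  incHead-injective : ∀ {α β} → incHead α ≡ incHead β → α ≡ β
  incHead-injective {[]}    {[]}    refl = refl
  incHead-injective {_ ∷ _} {_ ∷ _} refl = refl

  disjoint : ∀ {α} → α ∈ map (1 ∷_) (compositions (suc m)) ×
                     α ∈ map incHead (compositions (suc m)) → ⊥
  disjoint (α∈₁ , α∈₂)
    with _ , _ , refl ← ∈-map⁻ (1 ∷_) α∈₁ | ∈-map⁻ incHead α∈₂
  ... | zero ∷ _ , γ∈ , refl with () ∷ _ ← ∈-compositions⁻ (suc m) γ∈

∈-deviationSets : ∀ m δ α → α ∈ deviationSets m δ ⇔ IsDeviationSet m δ α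
∈-deviationSets m δ α = mk⇔
  (λ α∈ → proj₂ (∈-filter⁻ (isDeviationSet? m δ) {xs = compositions m} α∈))
  (λ dev → ∈-filter⁺ (isDeviationSet? m δ) (complete dev) dev)
  where
  complete : IsDeviationSet m δ α → α ∈ compositions m
  complete (mkDeviationSet p refl _ _) = ∈-compositions⁺ α p

deviationSets-unique : ∀ m δ → Unique (deviationSets m δ)
deviationSets-unique m δ =
  Unique.filter⁺ (isDeviationSet? m δ) (compositions-unique m)

-- ℚ[[x]]: a series is its sequence of coefficients.
Series : Set
Series = ℕ → ℚ

infixl 6 _⊕_ _⊖_
infixl 7 _⊛_
infixr 8 _^_

𝟙 : Series
𝟙 zero    = 1ℚ
𝟙 (suc _) = 0ℚ

𝕏 : Series
𝕏 (suc zero) = 1ℚ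
𝕏 _          = 0ℚ

_⊕_ _⊖_ _⊛_ : Series → Series → Series
(f ⊕ g) n = f n ℚ.+ g n
(f ⊖ g) n = f n ℚ.- g n
(f ⊛ g) n = ∑[ i ≤ n ] (f (toℕ i) ℚ.* g (n ℕ.∸ toℕ i))

_·_ : ℚ → Series → Series
(q · f) n = q ℚ.* f n

_^_ : Series → ℕ → Series
f ^ zero  = 𝟙
f ^ suc k = f ⊛ f ^ k

-- Newton's binomial series Σ C(1/2, n) (-4x)ⁿ; consecutive coefficients have
-- ratio -4 (1/2 - n) / (n + 1) = (4n - 2) / (n + 1).
√[1-4x] : Series
√[1-4x] zero    = 1ℚ
√[1-4x] (suc n) = √[1-4x] n ℚ.* ((+ (4 ℕ.* n) ℤ.- + 2) / suc n)

p : ℕ → Series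
p δ = (½ · (𝟙 ⊕ √[1-4x])) ^ (δ ℕ.+ 1) ⊕ (½ · (𝟙 ⊖ √[1-4x])) ^ (δ ℕ.+ 1)

-- The series is a polynomial of degree exactly d.
record HasDegree (f : Series) (d : ℕ) : Set where
  constructor mkHasDegree
  field
    leading≢0 : f d ≢ 0ℚ
    vanishes  : ∀ i → d < i → f i ≡ 0ℚ

fromℕ : ℕ → ℚ
fromℕ n = + n / 1

private

  s : Series
  s = √[1-4x]

  fromℤ : ℤ → ℚ
  fromℤ i = i / 1

  fromℤ-+ : ∀ i j → fromℤ (i ℤ.+ j) ≡ fromℤ i ℚ.+ fromℤ j
  fromℤ-+ i j = ℚ.toℚᵘ-injective (begin
    ℚ.toℚᵘ (fromℤ (i ℤ.+ j))                   ≈⟨ ℚ.toℚᵘ-fromℚᵘ (ℚᵘ.mkℚᵘ (i ℤ.+ j) 0) ⟩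
    ℚᵘ.mkℚᵘ (i ℤ.+ j) 0                        ≈⟨ ℚᵘ.*≡* (cong (ℤ._* + 1) (sym (cong₂ ℤ._+_ (ℤ.*-identityʳ i) (ℤ.*-identityʳ j)))) ⟩
    ℚᵘ.mkℚᵘ i 0 ℚᵘ.+ ℚᵘ.mkℚᵘ j 0               ≈⟨ ℚᵘ.+-cong (ℚ.toℚᵘ-fromℚᵘ (ℚᵘ.mkℚᵘ i 0)) (ℚ.toℚᵘ-fromℚᵘ (ℚᵘ.mkℚᵘ j 0)) ⟨
    ℚ.toℚᵘ (fromℤ i) ℚᵘ.+ ℚ.toℚᵘ (fromℤ j)     ≈⟨ ℚ.toℚᵘ-homo-+ (fromℤ i) (fromℤ j) ⟨
    ℚ.toℚᵘ (fromℤ i ℚ.+ fromℤ j)               ∎)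
    where open ℚᵘ.≃-Reasoning

  /-*-cancel : ∀ i n → (i / suc n) ℚ.* fromℕ (suc n) ≡ fromℤ i
  /-*-cancel i n = ℚ.toℚᵘ-injective (begin
    ℚ.toℚᵘ ((i / suc n) ℚ.* fromℕ (suc n))             ≈⟨ ℚ.toℚᵘ-homo-* (i / suc n) (fromℕ (suc n)) ⟩
    ℚ.toℚᵘ (i / suc n) ℚᵘ.* ℚ.toℚᵘ (fromℕ (suc n))     ≈⟨ ℚᵘ.*-cong (ℚ.toℚᵘ-fromℚᵘ (ℚᵘ.mkℚᵘ i n)) (ℚ.toℚᵘ-fromℚᵘ (ℚᵘ.mkℚᵘ (+ suc n) 0)) ⟩
    ℚᵘ.mkℚᵘ i n ℚᵘ.* ℚᵘ.mkℚᵘ (+ suc n) 0               ≈⟨ ℚᵘ.*≡* (trans (ℤ.*-identityʳ _) (cong (λ k → i ℤ.* + suc k) (sym (ℕ.*-identityʳ n)))) ⟩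
    ℚᵘ.mkℚᵘ i 0                                        ≈⟨ ℚ.toℚᵘ-fromℚᵘ (ℚᵘ.mkℚᵘ i 0) ⟨
    ℚ.toℚᵘ (fromℤ i)                                   ∎)
    where open ℚᵘ.≃-Reasoning

  fromℕ-+ : ∀ m n → fromℕ (m ℕ.+ n) ≡ fromℕ m ℚ.+ fromℕ n
  fromℕ-+ m n = fromℤ-+ (+ m) (+ n)

  4q : ℚ → ℚ
  4q q = q ℚ.+ (q ℚ.+ (q ℚ.+ (q ℚ.+ 0ℚ)))

  s-suc : ∀ n → fromℕ (suc n) ℚ.* s (suc n) ≡ (4q (fromℕ n) ℚ.- (1ℚ ℚ.+ 1ℚ)) ℚ.* s n
  s-suc n = begin
    fromℕ (suc n) ℚ.* (s n ℚ.* r)          ≡⟨ solve 3 (λ a b c → a :* (b :* c) := c :* a :* b) refl (fromℕ (suc n)) (s n) r ⟩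
    r ℚ.* fromℕ (suc n) ℚ.* s n            ≡⟨ cong (ℚ._* s n) (/-*-cancel (+ (4 ℕ.* n) ℤ.- + 2) n) ⟩
    fromℤ (+ (4 ℕ.* n) ℤ.- + 2) ℚ.* s n    ≡⟨ cong (ℚ._* s n) (trans (fromℤ-+ (+ (4 ℕ.* n)) (ℤ.- + 2)) (cong (ℚ._- (1ℚ ℚ.+ 1ℚ)) lemma)) ⟩
    (4q (fromℕ n) ℚ.- (1ℚ ℚ.+ 1ℚ)) ℚ.* s n ∎
    where
    open ≡-Reasoning
    open +-*-Solver
    r = (+ (4 ℕ.* n) ℤ.- + 2) / suc n
    lemma : fromℕ (4 ℕ.* n) ≡ 4q (fromℕ n)
    lemma = trans (fromℕ-+ n _) (cong (fromℕ n ℚ.+_)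
      (trans (fromℕ-+ n _) (cong (fromℕ n ℚ.+_)
      (trans (fromℕ-+ n _) (cong (fromℕ n ℚ.+_) (fromℕ-+ n 0))))))

  s×s : ∀ n → Fin (suc n) → ℚ
  s×s n i = s (toℕ i) ℚ.* s (n ℕ.∸ toℕ i)

  -- D n is the n-th coefficient of (x s′) s.
  D : Series
  D n = ∑[ i ≤ n ] (fromℕ (toℕ i) ℚ.* s×s n i)

  D+D : ∀ n → D n ℚ.+ D n ≡ fromℕ n ℚ.* (s ⊛ s) n
  D+D n = begin
    D n ℚ.+ D n
      ≡⟨ cong (D n ℚ.+_) (trans (∑-permute {suc n} (λ i → fromℕ (toℕ i) ℚ.* s×s n i) Perm.reverse)
           (sum-cong-≗ {suc n} flip)) ⟩
    D n ℚ.+ (∑[ i ≤ n ] (fromℕ (n ℕ.∸ toℕ i) ℚ.* s×s n i))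
      ≡⟨ ∑-distrib-+ {suc n} (λ i → fromℕ (toℕ i) ℚ.* s×s n i) (λ i → fromℕ (n ℕ.∸ toℕ i) ℚ.* s×s n i) ⟨
    ∑[ i ≤ n ] (fromℕ (toℕ i) ℚ.* s×s n i ℚ.+ fromℕ (n ℕ.∸ toℕ i) ℚ.* s×s n i)
      ≡⟨ sum-cong-≗ {suc n} (λ i → trans (sym (ℚ.*-distribʳ-+ (s×s n i) (fromℕ (toℕ i)) (fromℕ (n ℕ.∸ toℕ i))))
           (cong (ℚ._* s×s n i) (trans (sym (fromℕ-+ (toℕ i) (n ℕ.∸ toℕ i))) (cong fromℕ (ℕ.m+[n∸m]≡n (Fin.toℕ≤pred[n] i)))))) ⟩
    ∑[ i ≤ n ] (fromℕ n ℚ.* s×s n i)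
      ≡⟨ *-distribˡ-sum (fromℕ n) (s×s n) ⟨
    fromℕ n ℚ.* (s ⊛ s) n ∎
    where
    open ≡-Reasoning
    flip : (i : Fin (suc n)) → let j = toℕ (Perm.reverse Perm.⟨$⟩ʳ i) in
           fromℕ j ℚ.* (s j ℚ.* s (n ℕ.∸ j)) ≡ fromℕ (n ℕ.∸ toℕ i) ℚ.* s×s n i
    flip i rewrite Fin.opposite-prop i | ℕ.m∸[m∸n]≡n (Fin.toℕ≤pred[n] i) =
      cong (fromℕ (n ℕ.∸ toℕ i) ℚ.*_) (ℚ.*-comm (s (n ℕ.∸ toℕ i)) (s (toℕ i)))

  D-suc : ∀ n → D (suc n) ≡ 4q (D n) ℚ.- ((s ⊛ s) n ℚ.+ (s ⊛ s) n)
  D-suc n = begin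
    D (suc n)
      ≡⟨ cong (ℚ._+ rest) (ℚ.*-zeroˡ (s 0 ℚ.* s (suc n))) ⟩
    0ℚ ℚ.+ rest
      ≡⟨ ℚ.+-identityˡ rest ⟩
    ∑[ i ≤ n ] (fromℕ (suc (toℕ i)) ℚ.* (s (suc (toℕ i)) ℚ.* s (n ℕ.∸ toℕ i)))
      ≡⟨ sum-cong-≗ {suc n} (λ i → trans (sym (ℚ.*-assoc (fromℕ (suc (toℕ i))) (s (suc (toℕ i))) (s (n ℕ.∸ toℕ i)))) (trans (cong (ℚ._* s (n ℕ.∸ toℕ i)) (s-suc (toℕ i)))
           (solve 3 (λ a b c → ((a :+ (a :+ (a :+ (a :+ con 0ℚ)))) :- (con 1ℚ :+ con 1ℚ)) :* b :* c
              := con four :* (a :* (b :* c)) :+ con -two :* (b :* c)) refl (fromℕ (toℕ i)) (s (toℕ i)) (s (n ℕ.∸ toℕ i))))) ⟩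
    ∑[ i ≤ n ] (four ℚ.* (fromℕ (toℕ i) ℚ.* s×s n i) ℚ.+ -two ℚ.* s×s n i)
      ≡⟨ ∑-distrib-+ {suc n} (λ i → four ℚ.* (fromℕ (toℕ i) ℚ.* s×s n i)) (λ i → -two ℚ.* s×s n i) ⟩
    (∑[ i ≤ n ] (four ℚ.* (fromℕ (toℕ i) ℚ.* s×s n i))) ℚ.+ (∑[ i ≤ n ] (-two ℚ.* s×s n i))
      ≡⟨ cong₂ ℚ._+_ (*-distribˡ-sum {suc n} four (λ i → fromℕ (toℕ i) ℚ.* s×s n i)) (*-distribˡ-sum -two (s×s n)) ⟨
    four ℚ.* D n ℚ.+ -two ℚ.* (s ⊛ s) n
      ≡⟨ solve 2 (λ a t → con four :* a :+ con -two :* t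
           := (a :+ (a :+ (a :+ (a :+ con 0ℚ)))) :- (t :+ t)) refl (D n) ((s ⊛ s) n) ⟩
    4q (D n) ℚ.- ((s ⊛ s) n ℚ.+ (s ⊛ s) n) ∎
    where
    open ≡-Reasoning
    open +-*-Solver
    four = fromℕ 4
    rest = ∑[ i ≤ n ] (fromℕ (suc (toℕ i)) ℚ.* (s (suc (toℕ i)) ℚ.* s (n ℕ.∸ toℕ i)))
    -two = ℚ.- (1ℚ ℚ.+ 1ℚ)

  s²-suc : ∀ n → fromℕ (suc n) ℚ.* (s ⊛ s) (suc n) ≡ fromℕ 4 ℚ.* (fromℕ n ℚ.- 1ℚ) ℚ.* (s ⊛ s) n
  s²-suc n = begin
    fromℕ (suc n) ℚ.* (s ⊛ s) (suc n)   ≡⟨ D+D (suc n) ⟨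
    D (suc n) ℚ.+ D (suc n)             ≡⟨ cong (λ d → d ℚ.+ d) (D-suc n) ⟩
    d₁ ℚ.+ d₁                           ≡⟨ solve 2 (λ a t → let d = (a :+ (a :+ (a :+ (a :+ con 0ℚ)))) :- (t :+ t) in d :+ d := con (fromℕ 4) :* ((a :+ a) :- t)) refl (D n) t ⟩
    fromℕ 4 ℚ.* (D n ℚ.+ D n ℚ.- t)     ≡⟨ cong (λ d → fromℕ 4 ℚ.* (d ℚ.- t)) (D+D n) ⟩
    fromℕ 4 ℚ.* (fromℕ n ℚ.* t ℚ.- t)   ≡⟨ solve 2 (λ a t → con (fromℕ 4) :* (a :* t :- t) := con (fromℕ 4) :* (a :- con 1ℚ) :* t) refl (fromℕ n) t ⟩
    fromℕ 4 ℚ.* (fromℕ n ℚ.- 1ℚ) ℚ.* t  ∎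
    where
    open ≡-Reasoning
    open +-*-Solver
    t = (s ⊛ s) n
    d₁ = 4q (D n) ℚ.- (t ℚ.+ t)

  *-cancelˡ-0 : ∀ n q → fromℕ (suc n) ℚ.* q ≡ 0ℚ → q ≡ 0ℚ
  *-cancelˡ-0 n q eq = begin
    q                                          ≡⟨ ℚ.*-identityˡ q ⟨
    1ℚ ℚ.* q                                   ≡⟨ cong (ℚ._* q) inv ⟨
    (+ 1 / suc n) ℚ.* fromℕ (suc n) ℚ.* q      ≡⟨ ℚ.*-assoc (+ 1 / suc n) _ q ⟩
    (+ 1 / suc n) ℚ.* (fromℕ (suc n) ℚ.* q)    ≡⟨ cong ((+ 1 / suc n) ℚ.*_) eq ⟩
    (+ 1 / suc n) ℚ.* 0ℚ                       ≡⟨ ℚ.*-zeroʳ (+ 1 / suc n) ⟩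
    0ℚ                                         ∎
    where
    open ≡-Reasoning
    inv : (+ 1 / suc n) ℚ.* fromℕ (suc n) ≡ 1ℚ
    inv = /-*-cancel (+ 1) n

√[1-4x]-squared : ∀ n → (√[1-4x] ⊛ √[1-4x]) n ≡ (𝟙 ⊖ (fromℕ 4 · 𝕏)) n
√[1-4x]-squared 0             = refl
√[1-4x]-squared 1             = refl
√[1-4x]-squared 2             = refl
√[1-4x]-squared (suc n@(suc (suc _))) = *-cancelˡ-0 n ((s ⊛ s) (suc n)) (begin
  fromℕ (suc n) ℚ.* (s ⊛ s) (suc n)                 ≡⟨ s²-suc n ⟩
  fromℕ 4 ℚ.* (fromℕ n ℚ.- 1ℚ) ℚ.* (s ⊛ s) n        ≡⟨ cong (fromℕ 4 ℚ.* (fromℕ n ℚ.- 1ℚ) ℚ.*_) (√[1-4x]-squared n) ⟩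
  fromℕ 4 ℚ.* (fromℕ n ℚ.- 1ℚ) ℚ.* 0ℚ               ≡⟨ ℚ.*-zeroʳ (fromℕ 4 ℚ.* (fromℕ n ℚ.- 1ℚ)) ⟩
  0ℚ                                                ∎)
  where open ≡-Reasoning

{-# OPTIONS --safe #-}
module Submission where

-- Reading a deviation set as the run lengths of a ±1 walk from 0 whose first
-- step is upwards, ζ(m, δ) is for m ≥ 1 half the number of m-step walks from 0
-- that stay in [-δ, δ] and end in {-1, 0, 1}. By symmetry only the distance j
-- from the centre matters; let w m j be the number of such walks from j.
-- With S the shift in m, S w(j) = w(j + 1) + w(j − 1) and S w(0) = 2 w(1), so
-- w(j) = ½ Q_j(S) w(0) for the polynomials Q₀ = 2, Q₁ = S,
-- Q_{j+2} = S Q_{j+1} − Q_j, as long as j ≤ δ + 1. The power sums of the two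
-- roots of y² = y − x satisfy P_{j+2} = P_{j+1} − x P_j, so Q_j(S) = S^j P_j(S⁻²),
-- and w(δ + 1) = 0 is the recurrence with coefficients p_δ = P_{δ+1}.

open import Defs
open import Algebra.Bundles using (module CommutativeRing)
import Algebra.Properties.Semiring.Sum as Sum
open import Data.Bool.Base using (if_then_else_)
open import Data.Fin.Base using (Fin; suc; toℕ)
import Data.Fin.Properties as Fin
open import Data.Integer.Base as ℤ using (ℤ; +_; -[1+_]; 1ℤ; ∣_∣)
import Data.Integer.Properties as ℤ
import Data.Integer.Solver as ℤ-Solver
open import Data.List.Base using (List; []; _∷_; _++_; map; take; length; filter)
open import Data.List.Properties using (filter-++; filter-accept; filter-none; filter-reject; length-++; map-id)
open import Data.List.Relation.Unary.All as All using (All; []; _∷_)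
import Data.List.Relation.Unary.All.Properties as All
open import Data.Nat.Base using (ℕ; zero; suc; _+_; _*_; _∸_; _≤_; _<_; z≤n; s≤s; ⌊_/2⌋; ∣_-_∣)
open import Data.Nat.ListAction using (sum)
import Data.Nat.Properties as ℕ
open import Data.Product.Base using (_×_; _,_; proj₁; proj₂; ∃-syntax)
open import Data.Rational.Base as ℚ using (ℚ; 0ℚ; 1ℚ; ½)
import Data.Rational.Properties as ℚ
open import Data.Rational.Solver using (module +-*-Solver)
import Data.Rational.Unnormalised.Base as ℚᵘ
import Data.Rational.Unnormalised.Properties as ℚᵘ
open import Function.Base using (_∘_; id)
open import Level using (Level)
open import Relation.Binary.PropositionalEquality using (_≡_; _≗_; refl; sym; trans; cong; cong₂; subst; module ≡-Reasoning)
open import Relation.Nullary using (¬_; yes; no; does; contradiction)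
open import Relation.Nullary.Decidable using (_×-dec_; dec-true; dec-false)
open import Relation.Unary using (Pred; Decidable)

open Sum (CommutativeRing.semiring ℚ.+-*-commutativeRing)
  using (sum-cong-≗; ∑-distrib-+; *-distribˡ-sum; sum-replicate-zero)

-- Counting the elements of a list that satisfy a predicate

private variable
  ℓ ℓ₁ ℓ₂ : Level
  A B : Set ℓ

count : {P : Pred A ℓ₁} → Decidable P → List A → ℕ
count P? xs = length (filter P? xs)

count-++ : {P : Pred A ℓ₁} (P? : Decidable P) (xs ys : List A) →
           count P? (xs ++ ys) ≡ count P? xs + count P? ys
count-++ P? xs ys = trans (cong length (filter-++ P? xs ys)) (length-++ (filter P? xs))

-- Asking for the equivalence only at the elements of `xs` lets it depend on what is known about
-- them, such as their sum.
count-map : {P : Pred A ℓ₁} {Q : Pred B ℓ₂} (P? : Decidable P) (Q? : Decidable Q) (f : A → B) {xs : List A} →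
            All (λ x → (P x → Q (f x)) × (Q (f x) → P x)) xs →
            count Q? (map f xs) ≡ count P? xs
count-map P? Q? f [] = refl
count-map P? Q? f {x ∷ xs} ((to , from) ∷ rest) with P? x
... | yes px = trans (cong length (filter-accept Q? (to px))) (cong suc (count-map P? Q? f rest))
... | no ¬px = trans (cong length (filter-reject Q? (¬px ∘ from))) (count-map P? Q? f rest)

count-none : {P : Pred A ℓ₁} (P? : Decidable P) {xs : List A} → All (¬_ ∘ P) xs → count P? xs ≡ 0
count-none P? none = cong length (filter-none P? none)

-- Walks in an interval and their run lengths

-- As `∣ j - 1 ∣` sends 0 to 1, both steps from the centre are counted. The bound `δ` is tested
-- where a step is taken; at the end the test `j ≤ 1` takes its place, which suffices when `1 ≤ δ`.
walks : ℕ → ℕ → ℕ → ℕ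
walks δ zero    j = if does (j ℕ.≤? 1) then 1 else 0
walks δ (suc m) j = if does (j ℕ.≤? δ) then walks δ m (suc j) + walks δ m ∣ j - 1 ∣ else 0

walks-step : ∀ δ m {j} → j ≤ δ → walks δ (suc m) j ≡ walks δ m (suc j) + walks δ m ∣ j - 1 ∣
walks-step δ m {j} j≤δ rewrite dec-true (j ℕ.≤? δ) j≤δ = refl

-- The boundary condition, which at `j = δ + 1` becomes the recurrence. With no steps left,
-- `1 ≤ δ < j` puts `j` beyond the permitted end positions.
walks-outside : ∀ {δ} → 1 ≤ δ → ∀ m {j} → δ < j → walks δ m j ≡ 0
walks-outside     1≤δ zero    {suc zero}    δ<1 = contradiction (ℕ.≤-trans δ<1 1≤δ) (ℕ.<-irrefl refl)
walks-outside     1≤δ zero    {suc (suc j)} δ<j = refl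
walks-outside {δ} 1≤δ (suc m) {j}           δ<j rewrite dec-false (j ℕ.≤? δ) (ℕ.<⇒≱ δ<j) = refl

-- The walk is reflected in 0 after each run, so that the next run again goes
-- upwards; z is the current, reflected position.
Good : ℕ → ℤ → List ℕ → Set
Good δ z []      = ∣ z ∣ ≤ 1
Good δ z (a ∷ α) = ∣ z ℤ.+ + a ∣ ≤ δ × Good δ (ℤ.- (z ℤ.+ + a)) α

good? : ∀ δ z → Decidable (Good δ z)
good? δ z []      = ∣ z ∣ ℕ.≤? 1
good? δ z (a ∷ α) = (∣ z ℤ.+ + a ∣ ℕ.≤? δ) ×-dec good? δ (ℤ.- (z ℤ.+ + a)) α

-- The reflection after a run matches the sign change in `altSum`: the two integers are opposite, so
-- their absolute values agree.
take-step : ∀ z a i → ∣ ℤ.- (z ℤ.+ a) ℤ.+ i ∣ ≡ ∣ z ℤ.+ (a ℤ.- i) ∣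
take-step z a i = trans
  (cong ∣_∣ (solve 3 (λ z a i → :- (z :+ a) :+ i := :- (z :+ (a :- i))) refl z a i))
  (ℤ.∣-i∣≡∣i∣ (z ℤ.+ (a ℤ.- i)))
  where open ℤ-Solver.+-*-Solver

∣+0∣ : ∀ z {n} → ∣ z ∣ ≤ n → ∣ z ℤ.+ + 0 ∣ ≤ n
∣+0∣ z = subst (λ i → ∣ i ∣ ≤ _) (sym (ℤ.+-identityʳ z))

-- The case `j = 0`, where the partial sum is `z` itself, is included so that the bound at `j` for
-- the tail yields the bound at `suc j` for the whole list.
good-altSum : ∀ {δ} z α → ∣ z ∣ ≤ δ → Good δ z α →
              (∀ j → ∣ z ℤ.+ altSum (take j α) ∣ ≤ δ) × ∣ z ℤ.+ altSum α ∣ ≤ 1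
good-altSum z []      z≤δ z≤1      = (λ { zero → ∣+0∣ z z≤δ ; (suc j) → ∣+0∣ z z≤δ }) , ∣+0∣ z z≤1
good-altSum z (a ∷ α) z≤δ (y≤δ , g)
  with bnd , end ← good-altSum (ℤ.- (z ℤ.+ + a)) α (subst (_≤ _) (sym (ℤ.∣-i∣≡∣i∣ (z ℤ.+ + a))) y≤δ) g
  = (λ { zero → ∣+0∣ z z≤δ ; (suc j) → subst (_≤ _) (take-step z (+ a) _) (bnd j) })
  , subst (_≤ 1) (take-step z (+ a) (altSum α)) end

altSum-good : ∀ {δ} z α → (∀ j → ∣ z ℤ.+ altSum (take j α) ∣ ≤ δ) → ∣ z ℤ.+ altSum α ∣ ≤ 1 → Good δ z α
altSum-good z []      bnd end = subst (λ i → ∣ i ∣ ≤ 1) (ℤ.+-identityʳ z) end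
altSum-good {δ} z (a ∷ α) bnd end =
    -- `take 1` leaves the first run alone, so `bnd 1` bounds the point where that run ends.
    subst (λ i → ∣ z ℤ.+ i ∣ ≤ δ) (ℤ.+-identityʳ (+ a)) (bnd 1)
  , altSum-good (ℤ.- (z ℤ.+ + a)) α
      (λ j → subst (_≤ _) (sym (take-step z (+ a) _)) (bnd (suc j)))
      (subst (_≤ 1) (sym (take-step z (+ a) (altSum α))) end)

-- Dropping the first term swaps `odds` and `evens`, just as it flips the sign of the alternating
-- sum.
altSum-odds-evens : ∀ α → altSum α ≡ + sum (odds α) ℤ.- + sum (evens α)
altSum-odds-evens []      = refl
altSum-odds-evens (a ∷ α) = begin
  + a ℤ.- altSum α
    ≡⟨ cong (λ i → + a ℤ.- i) (altSum-odds-evens α) ⟩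
  + a ℤ.- (+ sum (odds α) ℤ.- + sum (evens α))
    ≡⟨ solve 3 (λ a o e → a :- (o :- e) := (a :+ e) :- o) refl (+ a) (+ sum (odds α)) (+ sum (evens α)) ⟩
  + (a + sum (evens α)) ℤ.- + sum (odds α) ∎
  where
  open ≡-Reasoning
  open ℤ-Solver.+-*-Solver

∣m⊖n∣≡∣m-n∣ : ∀ m n → ∣ m ℤ.⊖ n ∣ ≡ ∣ m - n ∣
∣m⊖n∣≡∣m-n∣ zero    zero    = refl
∣m⊖n∣≡∣m-n∣ zero    (suc n) = refl
∣m⊖n∣≡∣m-n∣ (suc m) zero    = refl
∣m⊖n∣≡∣m-n∣ (suc m) (suc n) = trans (cong ∣_∣ (ℤ.[1+m]⊖[1+n]≡m⊖n m n)) (∣m⊖n∣≡∣m-n∣ m n)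

∣altSum∣ : ∀ α → ∣ altSum α ∣ ≡ ∣ sum (odds α) - sum (evens α) ∣
∣altSum∣ α = trans
  (cong ∣_∣ (trans (altSum-odds-evens α) (ℤ.m-n≡m⊖n (sum (odds α)) (sum (evens α)))))
  (∣m⊖n∣≡∣m-n∣ (sum (odds α)) (sum (evens α)))

-- Deviation sets counted by walks

compositions-sum : ∀ m → All (λ α → sum α ≡ m) (compositions m)
compositions-sum zero          = refl ∷ []
compositions-sum (suc zero)    = refl ∷ []
compositions-sum (suc (suc m)) = All.++⁺
  (All.map⁺ (All.map (cong suc) (compositions-sum (suc m))))
  (All.map⁺ (All.map (λ {α} → sum-incHead α) (compositions-sum (suc m))))
  where
  sum-incHead : ∀ α → sum α ≡ suc m → sum (incHead α) ≡ suc (suc m)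
  sum-incHead (_ ∷ _) = cong suc

∣0+∣ : ∀ z → ∣ + 0 ℤ.+ z ∣ ≡ ∣ z ∣
∣0+∣ z = cong ∣_∣ (ℤ.+-identityˡ z)

deviation⇒good : ∀ {m δ α} → IsDeviationSet m δ α → Good δ (+ 0) α
deviation⇒good {δ = δ} {α} (mkDeviationSet _ _ balanced bounded) = altSum-good (+ 0) α
  (λ { zero → z≤n ; j@(suc _) → subst (_≤ δ) (sym (∣0+∣ (altSum (take j α)))) (bounded j (s≤s z≤n)) })
  (subst (_≤ 1) (sym (trans (∣0+∣ (altSum α)) (∣altSum∣ α))) balanced)

good⇒deviation : ∀ {m δ α} → All (0 <_) α → sum α ≡ m → Good δ (+ 0) α → IsDeviationSet m δ α
good⇒deviation {δ = δ} {α} pos sum≡m g with bnd , end ← good-altSum (+ 0) α z≤n g = mkDeviationSet pos sum≡m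
  (subst (_≤ 1) (trans (∣0+∣ (altSum α)) (∣altSum∣ α)) end)
  (λ j _ → subst (_≤ δ) (∣0+∣ (altSum (take j α))) (bnd j))

-- compositions (suc m) is read as: one step up, from z to 1 + z, then m free steps.
count-good : ∀ m {δ} → 1 ≤ δ → ∀ z → ℤ.- + δ ℤ.≤ 1ℤ ℤ.+ z →
             count (good? δ z) (compositions (suc m)) ≡ walks δ m ∣ 1ℤ ℤ.+ z ∣
count-good zero {δ} 1≤δ z _ with ∣ 1ℤ ℤ.+ z ∣ ℕ.≤? 1
-- The only composition is `1 ∷ []`. A walk that ends within distance 1 of the centre respects the
-- bound there because `1 ≤ δ`.
... | yes y≤1 rewrite dec-true (∣ 1ℤ ℤ.+ z ∣ ℕ.≤? 1) y≤1 = cong length (filter-accept (good? δ z) {x = 1 ∷ []} {xs = []}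
      ( subst (λ i → ∣ i ∣ ≤ δ) (ℤ.+-comm 1ℤ z) (ℕ.≤-trans y≤1 1≤δ)
      , subst (_≤ 1) (trans (cong ∣_∣ (ℤ.+-comm 1ℤ z)) (sym (ℤ.∣-i∣≡∣i∣ (z ℤ.+ 1ℤ)))) y≤1))
... | no  y≰1 rewrite dec-false (∣ 1ℤ ℤ.+ z ∣ ℕ.≤? 1) y≰1 = cong length (filter-reject (good? δ z) {x = 1 ∷ []} {xs = []}
      (y≰1 ∘ subst (_≤ 1) (sym (trans (cong ∣_∣ (ℤ.+-comm 1ℤ z)) (sym (ℤ.∣-i∣≡∣i∣ (z ℤ.+ 1ℤ))))) ∘ proj₂))
count-good (suc m) {δ} 1≤δ z -δ≤y = begin
  -- After one step up the walk stands at `y`. A first term 1 means turning there, with reflection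
  -- to `- y`; `incHead` means that the run goes on, as if it had started at `y`.
  count (good? δ z) (map (1 ∷_) C ++ map incHead C)
    ≡⟨ count-++ (good? δ z) (map (1 ∷_) C) (map incHead C) ⟩
  count (good? δ z) (map (1 ∷_) C) + count (good? δ z) (map incHead C)
    ≡⟨ cong (λ n → count (good? δ z) (map (1 ∷_) C) + n) (trans longer (count-good m 1≤δ y (ℤ.≤-trans -δ≤y (ℤ.i≤suc[i] y)))) ⟩
  count (good? δ z) (map (1 ∷_) C) + walks δ m (∣ 1ℤ ℤ.+ y ∣)
    ≡⟨ last-step ⟩
  walks δ (suc m) ∣ y ∣ ∎
  where
  open ≡-Reasoning
  C = compositions (suc m)
  y = 1ℤ ℤ.+ z

  y-head : ∀ a → z ℤ.+ + suc a ≡ y ℤ.+ + a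
  y-head a = solve 2 (λ z a → z :+ (con 1ℤ :+ a) := (con 1ℤ :+ z) :+ a) refl z (+ a)
    where open ℤ-Solver.+-*-Solver

  longer : count (good? δ z) (map incHead C) ≡ count (good? δ y) C
  longer = count-map (good? δ y) (good? δ z) incHead (All.map shift (compositions-sum (suc m)))
    where
    -- The positive sum excludes the empty list, which `incHead` would leave unchanged.
    shift : ∀ {α} → sum α ≡ suc m → (Good δ y α → Good δ z (incHead α)) × (Good δ z (incHead α) → Good δ y α)
    shift {a ∷ α} _ rewrite y-head a = (λ g → g) , (λ g → g)

  turn : ∣ y ∣ ≤ δ → count (good? δ z) (map (1 ∷_) C) ≡ count (good? δ (ℤ.- y)) C
  turn y≤δ = count-map (good? δ (ℤ.- y)) (good? δ z) (1 ∷_) (All.universal shift C)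
    where
    shift : ∀ α → (Good δ (ℤ.- y) α → Good δ z (1 ∷ α)) × (Good δ z (1 ∷ α) → Good δ (ℤ.- y) α)
    shift α rewrite ℤ.+-comm z 1ℤ = (y≤δ ,_) , proj₂

  -- `∣ 1 - y ∣` and `∣ 1 + y ∣` are the two neighbours of the distance `∣ y ∣`; the sign of `y`
  -- decides which is which.
  neighbours : ∀ y → walks δ m (∣ 1ℤ ℤ.- y ∣) + walks δ m (∣ 1ℤ ℤ.+ y ∣) ≡ walks δ m (suc (∣ y ∣)) + walks δ m (∣ (∣ y ∣) - 1 ∣)
  neighbours (+ zero)        = refl
  neighbours (+ suc zero)    = ℕ.+-comm (walks δ m 0) (walks δ m 2)
  neighbours (+ suc (suc n)) = ℕ.+-comm (walks δ m (suc n)) (walks δ m (3 + n))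
  neighbours -[1+ zero ]     = refl
  neighbours -[1+ suc n ]    = refl

  i≤δ⇒-δ≤-i : ∀ i → ∣ i ∣ ≤ δ → ℤ.- + δ ℤ.≤ ℤ.- i
  i≤δ⇒-δ≤-i (+ n)    i≤δ = ℤ.neg-mono-≤ (ℤ.+≤+ i≤δ)
  i≤δ⇒-δ≤-i -[1+ n ] i≤δ = ℤ.neg-≤-pos {δ}

  last-step : count (good? δ z) (map (1 ∷_) C) + walks δ m (∣ 1ℤ ℤ.+ y ∣) ≡ walks δ (suc m) ∣ y ∣
  last-step with ∣ y ∣ ℕ.≤? δ
  ... | yes y≤δ rewrite dec-true (∣ y ∣ ℕ.≤? δ) y≤δ = begin
    count (good? δ z) (map (1 ∷_) C) + walks δ m (∣ 1ℤ ℤ.+ y ∣)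
      ≡⟨ cong (λ n → n + walks δ m (∣ 1ℤ ℤ.+ y ∣)) (trans (turn y≤δ)
           (count-good m 1≤δ (ℤ.- y) (ℤ.≤-trans (i≤δ⇒-δ≤-i y y≤δ) (ℤ.i≤suc[i] (ℤ.- y))))) ⟩
    walks δ m (∣ 1ℤ ℤ.- y ∣) + walks δ m (∣ 1ℤ ℤ.+ y ∣)
      ≡⟨ neighbours y ⟩
    walks δ m (suc (∣ y ∣)) + walks δ m (∣ (∣ y ∣) - 1 ∣) ∎
  ... | no  y≰δ rewrite dec-false (∣ y ∣ ℕ.≤? δ) y≰δ = cong₂ _+_
    (count-none (good? δ z) (All.map⁺ (All.universal (λ α g → y≰δ (subst (λ i → ∣ i ∣ ≤ δ) (ℤ.+-comm z 1ℤ) (proj₁ g))) C)))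
    (outside y -δ≤y y≰δ)
    where
    -- The lower bound on `y` means that the interval can only have been left at the top. A longer
    -- run then stays outside, so testing run ends agrees with testing every position.
    outside : ∀ y → ℤ.- + δ ℤ.≤ y → ¬ ∣ y ∣ ≤ δ → walks δ m (∣ 1ℤ ℤ.+ y ∣) ≡ 0
    outside (+ n)    _    y≰δ = walks-outside 1≤δ m (ℕ.m≤n⇒m≤1+n (ℕ.≰⇒> y≰δ))
    outside -[1+ n ] -δ≤y y≰δ = contradiction (ℤ.drop‿+≤+ (ℤ.neg-cancel-≤ -δ≤y)) y≰δ

-- The first step from 0 is forced to go up to 1, which leaves `m` free steps.
ζ≡walks : ∀ m {δ} → 1 ≤ δ → ζ (suc m) δ ≡ walks δ m 1
ζ≡walks m {δ} 1≤δ = begin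
  -- Inserting `map id` lets `count-map` compare two predicates on one list.
  count (isDeviationSet? (suc m) δ) C            ≡⟨ cong (count (isDeviationSet? (suc m) δ)) (map-id C) ⟨
  count (isDeviationSet? (suc m) δ) (map id C)   ≡⟨ count-map (good? δ (+ 0)) (isDeviationSet? (suc m) δ) id good⇔deviation ⟩
  count (good? δ (+ 0)) C                        ≡⟨ count-good m 1≤δ (+ 0) (ℤ.neg-≤-pos {δ}) ⟩
  walks δ m 1                                    ∎
  where
  open ≡-Reasoning
  C = compositions (suc m)
  good⇔deviation = All.zipWith
    (λ (pos , sum≡m) → good⇒deviation pos sum≡m , deviation⇒good)
    (All.tabulate (∈-compositions⁻ (suc m)) , compositions-sum (suc m))

-- Algebra of formal power series

private variable
  f g f′ g′ : Series

⊛-cong : f ≗ f′ → g ≗ g′ → f ⊛ g ≗ f′ ⊛ g′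
⊛-cong f≗f′ g≗g′ n = sum-cong-≗ {suc n} (λ i → cong₂ ℚ._*_ (f≗f′ (toℕ i)) (g≗g′ (n ∸ toℕ i)))

⊛-distribʳ-⊕ : ∀ h f g → (f ⊕ g) ⊛ h ≗ (f ⊛ h) ⊕ (g ⊛ h)
⊛-distribʳ-⊕ h f g n = trans
  (sum-cong-≗ {suc n} (λ i → ℚ.*-distribʳ-+ (h (n ∸ toℕ i)) (f (toℕ i)) (g (toℕ i))))
  (∑-distrib-+ {suc n} (λ i → f (toℕ i) ℚ.* h (n ∸ toℕ i)) (λ i → g (toℕ i) ℚ.* h (n ∸ toℕ i)))

⊛-distribˡ-⊕ : ∀ h f g → h ⊛ (f ⊕ g) ≗ (h ⊛ f) ⊕ (h ⊛ g)
⊛-distribˡ-⊕ h f g n = trans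
  (sum-cong-≗ {suc n} (λ i → ℚ.*-distribˡ-+ (h (toℕ i)) (f (n ∸ toℕ i)) (g (n ∸ toℕ i))))
  (∑-distrib-+ {suc n} (λ i → h (toℕ i) ℚ.* f (n ∸ toℕ i)) (λ i → h (toℕ i) ℚ.* g (n ∸ toℕ i)))

·-⊛-assoc : ∀ q f g → (q · f) ⊛ g ≗ q · (f ⊛ g)
·-⊛-assoc q f g n = trans
  (sum-cong-≗ {suc n} (λ i → ℚ.*-assoc q (f (toℕ i)) (g (n ∸ toℕ i))))
  (sym (*-distribˡ-sum {suc n} q (λ i → f (toℕ i) ℚ.* g (n ∸ toℕ i))))

⊛-·-comm : ∀ q f g → f ⊛ (q · g) ≗ q · (f ⊛ g)
⊛-·-comm q f g n = trans
  (sum-cong-≗ {suc n} (λ i → solve 3 (λ q a b → a :* (q :* b) := q :* (a :* b)) refl q (f (toℕ i)) (g (n ∸ toℕ i))))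
  (sym (*-distribˡ-sum {suc n} q (λ i → f (toℕ i) ℚ.* g (n ∸ toℕ i))))
  where open +-*-Solver

⊛-zeroˡ : ∀ g → (λ _ → 0ℚ) ⊛ g ≗ (λ _ → 0ℚ)
⊛-zeroˡ g n = trans (sum-cong-≗ {suc n} (λ i → ℚ.*-zeroˡ (g (n ∸ toℕ i)))) (sum-replicate-zero (suc n))

⊛-identityˡ : ∀ f → 𝟙 ⊛ f ≗ f
⊛-identityˡ f zero    = trans (ℚ.+-identityʳ _) (ℚ.*-identityˡ (f 0))
⊛-identityˡ f (suc n) = trans (cong₂ ℚ._+_ (ℚ.*-identityˡ (f (suc n))) (⊛-zeroˡ f n)) (ℚ.+-identityʳ (f (suc n)))

⊛-identityʳ : ∀ f → f ⊛ 𝟙 ≗ f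
⊛-identityʳ f zero    = trans (ℚ.+-identityʳ _) (ℚ.*-identityʳ (f 0))
⊛-identityʳ f (suc n) = trans (cong₂ ℚ._+_ (ℚ.*-zeroʳ (f 0)) (⊛-identityʳ (f ∘ suc) n)) (ℚ.+-identityˡ (f (suc n)))

-- Splitting off the summand with index 0 gives, by computation, `(f ⊛ g) ∘ suc` as
-- `(f 0 · (g ∘ suc)) ⊕ ((f ∘ suc) ⊛ g)`. This reduces coefficient `suc n` for `f` to coefficient
-- `n` for `f ∘ suc`.
⊛-assoc : ∀ f g h → (f ⊛ g) ⊛ h ≗ f ⊛ (g ⊛ h)
⊛-assoc f g h zero = solve 3 (λ f g h → (f :* g :+ con 0ℚ) :* h :+ con 0ℚ := f :* (g :* h :+ con 0ℚ) :+ con 0ℚ)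
  refl (f 0) (g 0) (h 0)
  where open +-*-Solver
⊛-assoc f g h (suc n) = begin
  (f 0 ℚ.* g 0 ℚ.+ 0ℚ) ℚ.* h (suc n) ℚ.+ (((f 0 · (g ∘ suc)) ⊕ ((f ∘ suc) ⊛ g)) ⊛ h) n
    ≡⟨ cong ((f 0 ℚ.* g 0 ℚ.+ 0ℚ) ℚ.* h (suc n) ℚ.+_)
         (trans (⊛-distribʳ-⊕ h (f 0 · (g ∘ suc)) ((f ∘ suc) ⊛ g) n)
                (cong₂ ℚ._+_ (·-⊛-assoc (f 0) (g ∘ suc) h n) (⊛-assoc (f ∘ suc) g h n))) ⟩
  (f 0 ℚ.* g 0 ℚ.+ 0ℚ) ℚ.* h (suc n) ℚ.+ (f 0 ℚ.* ((g ∘ suc) ⊛ h) n ℚ.+ ((f ∘ suc) ⊛ (g ⊛ h)) n)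
    ≡⟨ solve 5 (λ f g h x y → (f :* g :+ con 0ℚ) :* h :+ (f :* x :+ y) := f :* (g :* h :+ x) :+ y)
         refl (f 0) (g 0) (h (suc n)) (((g ∘ suc) ⊛ h) n) (((f ∘ suc) ⊛ (g ⊛ h)) n) ⟩
  f 0 ℚ.* (g 0 ℚ.* h (suc n) ℚ.+ ((g ∘ suc) ⊛ h) n) ℚ.+ ((f ∘ suc) ⊛ (g ⊛ h)) n ∎
  where
  open ≡-Reasoning
  open +-*-Solver

-1ℚ : ℚ
-1ℚ = ℚ.- 1ℚ

⊖≗⊕- : ∀ f g → f ⊖ g ≗ f ⊕ (-1ℚ · g)
⊖≗⊕- f g n = solve 2 (λ a b → a :- b := a :+ con -1ℚ :* b) refl (f n) (g n)
  where open +-*-Solver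

⊛-distribʳ-⊖ : ∀ h f g → (f ⊖ g) ⊛ h ≗ (f ⊛ h) ⊖ (g ⊛ h)
⊛-distribʳ-⊖ h f g n = begin
  ((f ⊖ g) ⊛ h) n                   ≡⟨ ⊛-cong {g = h} (⊖≗⊕- f g) (λ _ → refl) n ⟩
  ((f ⊕ (-1ℚ · g)) ⊛ h) n           ≡⟨ ⊛-distribʳ-⊕ h f (-1ℚ · g) n ⟩
  (f ⊛ h) n ℚ.+ ((-1ℚ · g) ⊛ h) n   ≡⟨ cong ((f ⊛ h) n ℚ.+_) (·-⊛-assoc -1ℚ g h n) ⟩
  ((f ⊛ h) ⊕ (-1ℚ · (g ⊛ h))) n     ≡⟨ ⊖≗⊕- (f ⊛ h) (g ⊛ h) n ⟨
  ((f ⊛ h) ⊖ (g ⊛ h)) n             ∎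
  where open ≡-Reasoning

𝕏-⊛-suc : ∀ f n → (𝕏 ⊛ f) (suc n) ≡ f n
𝕏-⊛-suc f n = begin
  0ℚ ℚ.* f (suc n) ℚ.+ ((𝕏 ∘ suc) ⊛ f) n   ≡⟨ cong₂ ℚ._+_ (ℚ.*-zeroˡ (f (suc n))) (⊛-cong {g = f} 𝕏∘suc (λ _ → refl) n) ⟩
  0ℚ ℚ.+ (𝟙 ⊛ f) n                         ≡⟨ ℚ.+-identityˡ _ ⟩
  (𝟙 ⊛ f) n                                ≡⟨ ⊛-identityˡ f n ⟩
  f n                                      ∎
  where
  open ≡-Reasoning
  𝕏∘suc : 𝕏 ∘ suc ≗ 𝟙
  𝕏∘suc zero    = refl
  𝕏∘suc (suc n) = refl

-- The roots of y² = y - x and their power sums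

-- Both roots of y² = y − x arise in this way, from t = √(1 − 4x) and t = − √(1 − 4x).
half-root : ∀ t → t ⊛ t ≗ 𝟙 ⊖ (fromℕ 4 · 𝕏) →
            (½ · (𝟙 ⊕ t)) ⊛ (½ · (𝟙 ⊕ t)) ≗ (½ · (𝟙 ⊕ t)) ⊖ 𝕏
half-root t t² n = begin
  ((½ · u) ⊛ (½ · u)) n                     ≡⟨ ·-⊛-assoc ½ u (½ · u) n ⟩
  ½ ℚ.* (u ⊛ (½ · u)) n                     ≡⟨ cong (½ ℚ.*_) (⊛-·-comm ½ u u n) ⟩
  ½ ℚ.* (½ ℚ.* (u ⊛ u) n)                   ≡⟨ cong (λ q → ½ ℚ.* (½ ℚ.* q)) expand ⟩
  ½ ℚ.* (½ ℚ.* (𝟙 n ℚ.+ t n ℚ.+ (t n ℚ.+ (𝟙 n ℚ.- fromℕ 4 ℚ.* 𝕏 n))))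
    ≡⟨ solve 3 (λ o t x → con ½ :* (con ½ :* (o :+ t :+ (t :+ (o :- con (fromℕ 4) :* x))))
         := con ½ :* (o :+ t) :- x) refl (𝟙 n) (t n) (𝕏 n) ⟩
  ½ ℚ.* (𝟙 n ℚ.+ t n) ℚ.- 𝕏 n               ∎
  where
  open ≡-Reasoning
  open +-*-Solver
  u = 𝟙 ⊕ t
  expand : (u ⊛ u) n ≡ 𝟙 n ℚ.+ t n ℚ.+ (t n ℚ.+ (𝟙 n ℚ.- fromℕ 4 ℚ.* 𝕏 n))
  expand = trans (⊛-distribʳ-⊕ u 𝟙 t n) (cong₂ ℚ._+_ (⊛-identityˡ u n)
    (trans (⊛-distribˡ-⊕ t 𝟙 t n) (cong₂ ℚ._+_ (⊛-identityʳ t n) (t² n))))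

-- The equation of the root, multiplied by `a ^ k`.
root-power : ∀ a → a ⊛ a ≗ a ⊖ 𝕏 → ∀ k → a ^ suc (suc k) ≗ (a ^ suc k) ⊖ (𝕏 ⊛ a ^ k)
root-power a a² k n = begin
  (a ⊛ (a ⊛ a ^ k)) n     ≡⟨ ⊛-assoc a a (a ^ k) n ⟨
  ((a ⊛ a) ⊛ a ^ k) n     ≡⟨ ⊛-cong {g = a ^ k} a² (λ _ → refl) n ⟩
  ((a ⊖ 𝕏) ⊛ a ^ k) n     ≡⟨ ⊛-distribʳ-⊖ (a ^ k) a 𝕏 n ⟩
  ((a ⊛ a ^ k) ⊖ (𝕏 ⊛ a ^ k)) n ∎
  where open ≡-Reasoning

r₊ r₋ : Series
r₊ = ½ · (𝟙 ⊕ √[1-4x])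
r₋ = ½ · (𝟙 ⊖ √[1-4x])

r₊-root : r₊ ⊛ r₊ ≗ r₊ ⊖ 𝕏
r₊-root = half-root √[1-4x] √[1-4x]-squared

r₋-root : r₋ ⊛ r₋ ≗ r₋ ⊖ 𝕏
r₋-root n = begin
  (r₋ ⊛ r₋) n     ≡⟨ ⊛-cong r₋≗ r₋≗ n ⟩
  (r ⊛ r) n       ≡⟨ half-root -√ -√-squared n ⟩
  (r ⊖ 𝕏) n       ≡⟨ cong (ℚ._- 𝕏 n) (r₋≗ n) ⟨
  (r₋ ⊖ 𝕏) n      ∎
  where
  open ≡-Reasoning
  -√ = -1ℚ · √[1-4x]
  r = ½ · (𝟙 ⊕ -√)
  r₋≗ : r₋ ≗ r
  r₋≗ n = cong (½ ℚ.*_) (⊖≗⊕- 𝟙 √[1-4x] n)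
  -√-squared : -√ ⊛ -√ ≗ 𝟙 ⊖ (fromℕ 4 · 𝕏)
  -√-squared n = begin
    (-√ ⊛ -√) n                                  ≡⟨ ·-⊛-assoc -1ℚ √[1-4x] -√ n ⟩
    -1ℚ ℚ.* (√[1-4x] ⊛ -√) n                     ≡⟨ cong (-1ℚ ℚ.*_) (⊛-·-comm -1ℚ √[1-4x] √[1-4x] n) ⟩
    -1ℚ ℚ.* (-1ℚ ℚ.* (√[1-4x] ⊛ √[1-4x]) n)      ≡⟨ solve 1 (λ q → con -1ℚ :* (con -1ℚ :* q) := q) refl _ ⟩
    (√[1-4x] ⊛ √[1-4x]) n                        ≡⟨ √[1-4x]-squared n ⟩
    (𝟙 ⊖ (fromℕ 4 · 𝕏)) n                        ∎
    where open +-*-Solver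

powerSum : ℕ → Series
powerSum k = r₊ ^ k ⊕ r₋ ^ k

powerSum-0 : powerSum 0 ≗ fromℕ 2 · 𝟙
powerSum-0 zero    = refl
powerSum-0 (suc n) = refl

powerSum-1 : powerSum 1 ≗ 𝟙
powerSum-1 n = begin
  (r₊ ⊛ 𝟙) n ℚ.+ (r₋ ⊛ 𝟙) n   ≡⟨ cong₂ ℚ._+_ (⊛-identityʳ r₊ n) (⊛-identityʳ r₋ n) ⟩
  r₊ n ℚ.+ r₋ n               ≡⟨ solve 2 (λ o s → con ½ :* (o :+ s) :+ con ½ :* (o :- s) := o) refl (𝟙 n) (√[1-4x] n) ⟩
  𝟙 n                         ∎
  where
  open ≡-Reasoning
  open +-*-Solver

powerSum-suc-suc : ∀ k → powerSum (suc (suc k)) ≗ powerSum (suc k) ⊖ (𝕏 ⊛ powerSum k)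
powerSum-suc-suc k n = begin
  (r₊ ^ suc (suc k)) n ℚ.+ (r₋ ^ suc (suc k)) n
    ≡⟨ cong₂ ℚ._+_ (root-power r₊ r₊-root k n) (root-power r₋ r₋-root k n) ⟩
  (a ℚ.- c) ℚ.+ (b ℚ.- d)
    ≡⟨ solve 4 (λ a b c d → (a :- c) :+ (b :- d) := (a :+ b) :- (c :+ d)) refl a b c d ⟩
  (a ℚ.+ b) ℚ.- (c ℚ.+ d)
    ≡⟨ cong (λ q → (a ℚ.+ b) ℚ.- q) (⊛-distribˡ-⊕ 𝕏 (r₊ ^ k) (r₋ ^ k) n) ⟨
  powerSum (suc k) n ℚ.- (𝕏 ⊛ powerSum k) n ∎
  where
  open ≡-Reasoning
  open +-*-Solver
  a = (r₊ ^ suc k) n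
  b = (r₋ ^ suc k) n
  c = (𝕏 ⊛ r₊ ^ k) n
  d = (𝕏 ⊛ r₋ ^ k) n

powerSum-step : ∀ k i → powerSum (suc (suc k)) (suc i) ≡ powerSum (suc k) (suc i) ℚ.- powerSum k i
powerSum-step k i = trans (powerSum-suc-suc k (suc i))
  (cong (λ q → powerSum (suc k) (suc i) ℚ.- q) (𝕏-⊛-suc (powerSum k) i))

-- Subtracting a multiple of `𝕏` leaves the constant term alone. The index starts at 1, since
-- `powerSum 0` is the constant 2.
powerSum-constant : ∀ k → powerSum (suc k) 0 ≡ 1ℚ
powerSum-constant zero    = refl
powerSum-constant (suc k) = begin
  powerSum (suc (suc k)) 0                              ≡⟨ powerSum-suc-suc k 0 ⟩
  powerSum (suc k) 0 ℚ.- (0ℚ ℚ.* powerSum k 0 ℚ.+ 0ℚ)   ≡⟨ solve 2 (λ x y → x :- (con 0ℚ :* y :+ con 0ℚ) := x) refl (powerSum (suc k) 0) (powerSum k 0) ⟩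
  powerSum (suc k) 0                                    ≡⟨ powerSum-constant k ⟩
  1ℚ                                                    ∎
  where
  open ≡-Reasoning
  open +-*-Solver

-- Coefficients and degree of the power sums

fromℕ-+ : ∀ m n → fromℕ (m + n) ≡ fromℕ m ℚ.+ fromℕ n
fromℕ-+ m n = ℚ.toℚᵘ-injective (begin
  ℚ.toℚᵘ (fromℕ (m + n))                  ≈⟨ ℚ.toℚᵘ-fromℚᵘ (fromℕᵘ (m + n)) ⟩
  fromℕᵘ (m + n)                          ≈⟨ ℚᵘ.*≡* (cong (ℤ._* + 1) (sym (cong₂ ℤ._+_ (ℤ.*-identityʳ (+ m)) (ℤ.*-identityʳ (+ n))))) ⟩
  fromℕᵘ m ℚᵘ.+ fromℕᵘ n                  ≈⟨ ℚᵘ.+-cong (ℚ.toℚᵘ-fromℚᵘ (fromℕᵘ m)) (ℚ.toℚᵘ-fromℚᵘ (fromℕᵘ n)) ⟨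
  ℚ.toℚᵘ (fromℕ m) ℚᵘ.+ ℚ.toℚᵘ (fromℕ n)  ≈⟨ ℚ.toℚᵘ-homo-+ (fromℕ m) (fromℕ n) ⟨
  ℚ.toℚᵘ (fromℕ m ℚ.+ fromℕ n)            ∎)
  where
  open ℚᵘ.≃-Reasoning
  fromℕᵘ : ℕ → ℚᵘ.ℚᵘ
  fromℕᵘ n = ℚᵘ.mkℚᵘ (+ n) 0

fromℕ-injective : ∀ {m n} → fromℕ m ≡ fromℕ n → m ≡ n
fromℕ-injective {m} {n} eq with ℚᵘ.*≡* eq′ ← ℚ./-injective-≃ (ℚᵘ.mkℚᵘ (+ m) 0) (ℚᵘ.mkℚᵘ (+ n) 0) eq =
  ℤ.+-injective (trans (sym (ℤ.*-identityʳ (+ m))) (trans eq′ (ℤ.*-identityʳ (+ n))))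

-- Absolute values of the coefficients of powerSum k, whose signs alternate.
lucas : ℕ → ℕ → ℕ
lucas 0             zero    = 2
lucas 0             (suc i) = 0
lucas 1             zero    = 1
lucas 1             (suc i) = 0
lucas (suc (suc k)) zero    = lucas (suc k) zero
lucas (suc (suc k)) (suc i) = lucas (suc k) (suc i) + lucas k i

lucas-vanishes : ∀ k {i} → ⌊ k /2⌋ < i → lucas k i ≡ 0
lucas-vanishes 0             {suc i} _         = refl
lucas-vanishes 1             {suc i} _         = refl
lucas-vanishes (suc (suc k)) {suc i} (s≤s k<i) = cong₂ _+_
  (lucas-vanishes (suc k) (ℕ.≤-<-trans (ℕ.⌊n/2⌋-mono (ℕ.n≤1+n (suc k))) (s≤s k<i)))
  (lucas-vanishes k k<i)

-- Natural numbers do not cancel, so the leading entry for `k + 2` is at least the one for `k`. This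
-- is what separating the signs achieves.
lucas-positive : ∀ k → 0 < lucas k ⌊ k /2⌋
lucas-positive 0             = s≤s z≤n
lucas-positive 1             = s≤s z≤n
lucas-positive (suc (suc k)) = ℕ.≤-trans (lucas-positive k) (ℕ.m≤n+m _ _)

sign : ℕ → ℚ
sign zero    = 1ℚ
sign (suc i) = ℚ.- sign i

sign² : ∀ i → sign i ℚ.* sign i ≡ 1ℚ
sign² zero    = refl
sign² (suc i) = trans (solve 1 (λ s → (:- s) :* (:- s) := s :* s) refl (sign i)) (sign² i)
  where open +-*-Solver

-- The shift by `𝕏` costs one sign, which turns the difference in `powerSum-step` into the sum in
-- `lucas`.
powerSum-lucas : ∀ k i → powerSum k i ≡ sign i ℚ.* fromℕ (lucas k i)
powerSum-lucas 0             zero    = refl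
powerSum-lucas 0             (suc i) = trans (powerSum-0 (suc i)) (sym (ℚ.*-zeroʳ (sign (suc i))))
powerSum-lucas 1             zero    = refl
powerSum-lucas 1             (suc i) = trans (powerSum-1 (suc i)) (sym (ℚ.*-zeroʳ (sign (suc i))))
powerSum-lucas (suc (suc k)) zero    = trans (trans (powerSum-constant (suc k)) (sym (powerSum-constant k)))
  (powerSum-lucas (suc k) zero)
powerSum-lucas (suc (suc k)) (suc i) = begin
  powerSum (suc (suc k)) (suc i)
    ≡⟨ powerSum-step k i ⟩
  powerSum (suc k) (suc i) ℚ.- powerSum k i
    ≡⟨ cong₂ ℚ._-_ (powerSum-lucas (suc k) (suc i)) (powerSum-lucas k i) ⟩
  (ℚ.- sign i) ℚ.* fromℕ (lucas (suc k) (suc i)) ℚ.- sign i ℚ.* fromℕ (lucas k i)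
    ≡⟨ solve 3 (λ s x y → (:- s) :* x :- s :* y := (:- s) :* (x :+ y)) refl (sign i) (fromℕ (lucas (suc k) (suc i))) (fromℕ (lucas k i)) ⟩
  (ℚ.- sign i) ℚ.* (fromℕ (lucas (suc k) (suc i)) ℚ.+ fromℕ (lucas k i))
    ≡⟨ cong ((ℚ.- sign i) ℚ.*_) (fromℕ-+ (lucas (suc k) (suc i)) (lucas k i)) ⟨
  (ℚ.- sign i) ℚ.* fromℕ (lucas (suc k) (suc i) + lucas k i) ∎
  where
  open ≡-Reasoning
  open +-*-Solver

powerSum-degree : ∀ k → HasDegree (powerSum k) ⌊ k /2⌋
powerSum-degree k = mkHasDegree
  -- `sign d` is its own inverse, so multiplying a vanishing leading coefficient by it would give
  -- `lucas k d ≡ 0`.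
  (λ eq → ℕ.<⇒≢ (lucas-positive k) (sym (fromℕ-injective (begin
    fromℕ (lucas k d)                               ≡⟨ ℚ.*-identityˡ _ ⟨
    1ℚ ℚ.* fromℕ (lucas k d)                        ≡⟨ cong (ℚ._* fromℕ (lucas k d)) (sign² d) ⟨
    sign d ℚ.* sign d ℚ.* fromℕ (lucas k d)         ≡⟨ ℚ.*-assoc (sign d) (sign d) _ ⟩
    sign d ℚ.* (sign d ℚ.* fromℕ (lucas k d))       ≡⟨ cong (sign d ℚ.*_) (trans (sym (powerSum-lucas k d)) eq) ⟩
    sign d ℚ.* 0ℚ                                   ≡⟨ ℚ.*-zeroʳ (sign d) ⟩
    0ℚ                                              ∎))))
  (λ i d<i → trans (powerSum-lucas k i)
    (trans (cong (λ c → sign i ℚ.* fromℕ c) (lucas-vanishes k d<i)) (ℚ.*-zeroʳ (sign i))))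
  where
  open ≡-Reasoning
  d = ⌊ k /2⌋

-- Shifted sums and walk counts

-- For N > n / 2 the truncated n ∸ 2 i occurs; shiftSum-walks holds nevertheless,
-- as the corresponding coefficients of powerSum k vanish.
shiftSum : ℕ → Series → (ℕ → ℚ) → ℕ → ℚ
shiftSum N c u n = ∑[ i < N ] (c (toℕ i) ℚ.* u (n ∸ 2 * toℕ i))

∑-zero : ∀ N {f : Fin N → ℚ} → (∀ i → f i ≡ 0ℚ) → ∑[ i < N ] f i ≡ 0ℚ
∑-zero N f≡0 = trans (sum-cong-≗ {N} f≡0) (sum-replicate-zero N)

module _ (u : ℕ → ℚ) where

  ∸-shift : ∀ n i → n ∸ 2 * suc i ≡ n ∸ 2 ∸ 2 * i
  ∸-shift n i = trans (cong (n ∸_) (ℕ.*-suc 2 i)) (sym (ℕ.∸-+-assoc n 2 (2 * i)))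

  -- The recurrence of the power sums with `𝕏` acting as a shift by 2. The head terms agree because
  -- both constant coefficients are 1, and lowering the index in the `powerSum k` part leaves `N`
  -- summands read from `n ∸ 2`.
  shiftSum-step : ∀ N k n → shiftSum (suc N) (powerSum (suc (suc k))) u n ≡
                  shiftSum (suc N) (powerSum (suc k)) u n ℚ.- shiftSum N (powerSum k) u (n ∸ 2)
  shiftSum-step N k n = begin
    shiftSum (suc N) (powerSum (suc (suc k))) u n
      ≡⟨ cong₂ ℚ._+_ (cong (ℚ._* u n) (trans (powerSum-constant (suc k)) (sym (powerSum-constant k)))) (sum-cong-≗ {N} tail) ⟩
    head ℚ.+ (∑[ i < N ] (a i ℚ.+ -1ℚ ℚ.* b i))
      ≡⟨ cong (head ℚ.+_) (trans (∑-distrib-+ {N} a (λ i → -1ℚ ℚ.* b i)) (cong (∑a ℚ.+_) (sym (*-distribˡ-sum {N} -1ℚ b)))) ⟩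
    head ℚ.+ (∑a ℚ.+ -1ℚ ℚ.* ∑b)
      ≡⟨ solve 3 (λ h a b → h :+ (a :+ con -1ℚ :* b) := h :+ a :- b) refl head ∑a ∑b ⟩
    head ℚ.+ ∑a ℚ.- ∑b ∎
    where
    open ≡-Reasoning
    open +-*-Solver
    head = powerSum (suc k) 0 ℚ.* u n
    a b : Fin N → ℚ
    a i = powerSum (suc k) (suc (toℕ i)) ℚ.* u (n ∸ 2 * suc (toℕ i))
    b i = powerSum k (toℕ i) ℚ.* u (n ∸ 2 ∸ 2 * toℕ i)
    ∑a = ∑[ i < N ] a i
    ∑b = ∑[ i < N ] b i
    tail : ∀ i → powerSum (suc (suc k)) (suc (toℕ i)) ℚ.* u (n ∸ 2 * suc (toℕ i)) ≡ a i ℚ.+ -1ℚ ℚ.* b i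
    tail i = begin
      powerSum (suc (suc k)) (suc (toℕ i)) ℚ.* u (n ∸ 2 * suc (toℕ i))
        ≡⟨ cong (ℚ._* u (n ∸ 2 * suc (toℕ i))) (powerSum-step k (toℕ i)) ⟩
      (powerSum (suc k) (suc (toℕ i)) ℚ.- powerSum k (toℕ i)) ℚ.* u (n ∸ 2 * suc (toℕ i))
        ≡⟨ solve 3 (λ x y v → (x :- y) :* v := x :* v :+ con -1ℚ :* (y :* v)) refl
             (powerSum (suc k) (suc (toℕ i))) (powerSum k (toℕ i)) (u (n ∸ 2 * suc (toℕ i))) ⟩
      a i ℚ.+ -1ℚ ℚ.* (powerSum k (toℕ i) ℚ.* u (n ∸ 2 * suc (toℕ i)))
        ≡⟨ cong (λ j → a i ℚ.+ -1ℚ ℚ.* (powerSum k (toℕ i) ℚ.* u j)) (∸-shift n (toℕ i)) ⟩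
      a i ℚ.+ -1ℚ ℚ.* b i ∎

  shiftSum-0 : ∀ N n → shiftSum (suc N) (powerSum 0) u n ≡ fromℕ 2 ℚ.* u n
  shiftSum-0 N n = trans (cong (fromℕ 2 ℚ.* u n ℚ.+_) (∑-zero N (λ i → ℚ.*-zeroˡ (u (n ∸ 2 * suc (toℕ i)))))) (ℚ.+-identityʳ _)

  shiftSum-1 : ∀ N n → shiftSum (suc N) (powerSum 1) u n ≡ u n
  shiftSum-1 N n = begin
    1ℚ ℚ.* u n ℚ.+ (∑[ i < N ] (powerSum 1 (suc (toℕ i)) ℚ.* u (n ∸ 2 * suc (toℕ i))))
      ≡⟨ cong₂ ℚ._+_ (ℚ.*-identityˡ (u n)) (∑-zero N (λ i →
           trans (cong (ℚ._* u (n ∸ 2 * suc (toℕ i))) (powerSum-1 (suc (toℕ i)))) (ℚ.*-zeroˡ (u (n ∸ 2 * suc (toℕ i)))))) ⟩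
    u n ℚ.+ 0ℚ
      ≡⟨ ℚ.+-identityʳ (u n) ⟩
    u n ∎
    where open ≡-Reasoning

half-double : ∀ q → ½ ℚ.* (q ℚ.+ q) ≡ q
half-double = solve 1 (λ q → con ½ :* (q :+ q) := q) refl
  where open +-*-Solver

-- Agrees with ζ except at n = 0, where ζ is 1.
halfReturns : ℕ → ℕ → ℚ
halfReturns δ n = ½ ℚ.* fromℕ (walks δ n 0)

-- Both steps from the centre lead to distance 1, and the factor `½` cancels this doubling.
halfReturns-suc : ∀ δ m → halfReturns δ (suc m) ≡ fromℕ (walks δ m 1)
halfReturns-suc δ m = trans (cong (½ ℚ.*_) (fromℕ-+ (walks δ m 1) (walks δ m 1))) (half-double _)

-- This is w(k) = ½ Q_k(S) w(0), by solving `walks-step` for the outer neighbour. The condition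
-- `k < 2 * N` keeps every nonzero coefficient inside the sum; `k ≤ suc δ` ensures that steps are
-- taken only from positions up to `δ`.
shiftSum-walks : ∀ {δ} N k → k < 2 * N → k ≤ suc δ → ∀ m →
                 shiftSum N (powerSum k) (halfReturns δ) (k + m) ≡ fromℕ (walks δ m k)
shiftSum-walks zero    k () _ m
shiftSum-walks {δ} (suc N) 0 _ _ m = trans (shiftSum-0 (halfReturns δ) N m)
  (solve 1 (λ q → con (fromℕ 2) :* (con ½ :* q) := q) refl (fromℕ (walks δ m 0)))
  where open +-*-Solver
shiftSum-walks {δ} (suc N) 1 _ _ m = trans (shiftSum-1 (halfReturns δ) N (suc m)) (halfReturns-suc δ m)
shiftSum-walks {δ} (suc N) (suc (suc k)) k<N (s≤s k<δ) m = begin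
  shiftSum (suc N) (powerSum (suc (suc k))) u (suc (suc (k + m)))
    ≡⟨ shiftSum-step u N k (suc (suc (k + m))) ⟩
  shiftSum (suc N) (powerSum (suc k)) u (suc (suc (k + m))) ℚ.- shiftSum N (powerSum k) u (k + m)
    ≡⟨ cong₂ ℚ._-_
         (trans (cong (shiftSum (suc N) (powerSum (suc k)) u ∘ suc) (sym (ℕ.+-suc k m)))
                (shiftSum-walks (suc N) (suc k) (ℕ.<⇒≤ k<N) (ℕ.m≤n⇒m≤1+n k<δ) (suc m)))
         (shiftSum-walks N k k<N′ (ℕ.≤-trans (ℕ.n≤1+n k) (ℕ.m≤n⇒m≤1+n k<δ)) m) ⟩
  fromℕ (walks δ (suc m) (suc k)) ℚ.- fromℕ (walks δ m k)
    ≡⟨ cong (λ w → fromℕ w ℚ.- fromℕ (walks δ m k)) (trans (walks-step δ m k<δ) (cong (λ j → walks δ m (suc (suc k)) + walks δ m j) (ℕ.∣-∣-identityʳ k))) ⟩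
  fromℕ (walks δ m (suc (suc k)) + walks δ m k) ℚ.- fromℕ (walks δ m k)
    ≡⟨ cong (ℚ._- fromℕ (walks δ m k)) (fromℕ-+ (walks δ m (suc (suc k))) (walks δ m k)) ⟩
  fromℕ (walks δ m (suc (suc k))) ℚ.+ fromℕ (walks δ m k) ℚ.- fromℕ (walks δ m k)
    ≡⟨ solve 2 (λ x y → x :+ y :- y := x) refl (fromℕ (walks δ m (suc (suc k)))) (fromℕ (walks δ m k)) ⟩
  fromℕ (walks δ m (suc (suc k))) ∎
  where
  open ≡-Reasoning
  open +-*-Solver
  u = halfReturns δ
  k<N′ : k < 2 * N
  k<N′ = ℕ.+-cancelˡ-< 2 k (2 * N) (subst (suc (suc k) <_) (ℕ.*-suc 2 N) k<N)

-- The recurrence for ζ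

ζ≡halfReturns : ∀ {δ n} → 1 ≤ δ → 1 ≤ n → fromℕ (ζ n δ) ≡ halfReturns δ n
ζ≡halfReturns {δ} {suc m} 1≤δ _ = trans (cong fromℕ (ζ≡walks m 1≤δ)) (sym (halfReturns-suc δ m))

n≤2⌊n/2⌋+1 : ∀ n → n ≤ 2 * ⌊ n /2⌋ + 1
n≤2⌊n/2⌋+1 0 = z≤n
n≤2⌊n/2⌋+1 1 = s≤s z≤n
n≤2⌊n/2⌋+1 (suc (suc n)) = subst (λ j → suc (suc n) ≤ j + 1) (sym (ℕ.*-suc 2 ⌊ n /2⌋)) (s≤s (s≤s (n≤2⌊n/2⌋+1 n)))

-- The bound on `m` serves twice: every argument of `ζ` stays positive, where `ζ` agrees with
-- `halfReturns`, and `suc δ ≤ 2 * d + 1 ≤ m` lets `m` be written as `suc δ + (m ∸ suc δ)`. The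
-- shifted sum then counts walks from `suc δ`, of which there are none.
powerSum-recurrence : ∀ {δ} → 1 ≤ δ → let d = ⌊ suc δ /2⌋ in ∀ m → 2 * d + 1 ≤ m →
  (∑[ i ≤ d ] (powerSum (suc δ) (toℕ i) ℚ.* fromℕ (ζ (m ∸ 2 * toℕ i) δ))) ≡ 0ℚ
powerSum-recurrence {δ} 1≤δ m 2d<m = begin
  ∑[ i ≤ d ] (powerSum (suc δ) (toℕ i) ℚ.* fromℕ (ζ (m ∸ 2 * toℕ i) δ))
    ≡⟨ sum-cong-≗ {suc d} (λ i → cong (powerSum (suc δ) (toℕ i) ℚ.*_) (ζ≡halfReturns 1≤δ (1≤m∸2i i))) ⟩
  shiftSum (suc d) (powerSum (suc δ)) (halfReturns δ) m
    ≡⟨ cong (shiftSum (suc d) (powerSum (suc δ)) (halfReturns δ)) (ℕ.m+[n∸m]≡n (ℕ.≤-trans (n≤2⌊n/2⌋+1 (suc δ)) 2d<m)) ⟨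
  shiftSum (suc d) (powerSum (suc δ)) (halfReturns δ) (suc δ + (m ∸ suc δ))
    ≡⟨ shiftSum-walks (suc d) (suc δ) δ<2d ℕ.≤-refl (m ∸ suc δ) ⟩
  fromℕ (walks δ (m ∸ suc δ) (suc δ))
    ≡⟨ cong fromℕ (walks-outside 1≤δ (m ∸ suc δ) ℕ.≤-refl) ⟩
  0ℚ ∎
  where
  open ≡-Reasoning
  d = ⌊ suc δ /2⌋
  1≤m∸2i : (i : Fin (suc d)) → 1 ≤ m ∸ 2 * toℕ i
  1≤m∸2i i = ℕ.m<n⇒0<n∸m (ℕ.≤-<-trans (ℕ.*-monoʳ-≤ 2 (Fin.toℕ≤pred[n] i)) (subst (_≤ m) (ℕ.+-comm (2 * d) 1) 2d<m))
  δ<2d : suc δ < 2 * suc d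
  δ<2d = subst (suc δ <_) (sym (ℕ.*-suc 2 d)) (s≤s (subst (suc δ ≤_) (ℕ.+-comm (2 * d) 1) (n≤2⌊n/2⌋+1 (suc δ))))

solve-constant : ∀ {c q r} → c ≡ 1ℚ → c ℚ.* q ℚ.+ r ≡ 0ℚ → q ≡ ℚ.- r
solve-constant {q = q} {r} refl eq = begin
  q                         ≡⟨ solve 2 (λ q r → q := (con 1ℚ :* q :+ r) :- r) refl q r ⟩
  (1ℚ ℚ.* q ℚ.+ r) ℚ.- r    ≡⟨ cong (ℚ._- r) eq ⟩
  0ℚ ℚ.- r                  ≡⟨ ℚ.+-identityˡ (ℚ.- r) ⟩
  ℚ.- r                     ∎
  where
  open ≡-Reasoning
  open +-*-Solver

-- Stated for any series, so that a single `subst` passes from `powerSum (suc δ)` to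
-- `powerSum (δ + 1)`, to which `p δ` unfolds.
Characteristic : ℕ → Series → Set
Characteristic δ f =
  ∃[ d ] (HasDegree f d
  × f 0 ≡ 1ℚ
  × (∀ m → 2 * d + 1 ≤ m → (∑[ i ≤ d ] (f (toℕ i) ℚ.* fromℕ (ζ (m ∸ 2 * toℕ i) δ))) ≡ 0ℚ)
  × (∀ m → 2 * d + 1 ≤ m →
       fromℕ (ζ m δ) ≡ ℚ.- (∑[ i < d ] (f (suc (toℕ i)) ℚ.* fromℕ (ζ (m ∸ 2 * suc (toℕ i)) δ)))))

powerSum-characteristic : ∀ {δ} → 1 ≤ δ → Characteristic δ (powerSum (suc δ))
powerSum-characteristic {δ} 1≤δ =
    ⌊ suc δ /2⌋
  , powerSum-degree (suc δ)
  , powerSum-constant δ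
  , powerSum-recurrence 1≤δ
  -- The summand with index 0 is the head of the sum, and its argument `m ∸ 2 * 0` computes to `m`.
  , λ m 2d<m → solve-constant (powerSum-constant δ) (powerSum-recurrence 1≤δ m 2d<m)

theorem2 : ∀ (δ : ℕ) → 1 ≤ δ →
    ∃[ d ] (HasDegree (p δ) d
    × p δ 0 ≡ 1ℚ
    × (∀ m → 2 * d + 1 ≤ m →
    (∑[ i ≤ d ] (p δ (toℕ i) ℚ.* fromℕ (ζ (m ∸ 2 * toℕ i) δ))) ≡ 0ℚ)
    × (∀ m → 2 * d + 1 ≤ m →
    fromℕ (ζ m δ) ≡ ℚ.- (∑[ i < d ] (p δ (suc (toℕ i)) ℚ.* fromℕ (ζ (m ∸ 2 * suc (toℕ i)) δ)))))
theorem2 δ 1≤δ = subst (λ k → Characteristic δ (powerSum k)) (ℕ.+-comm 1 δ) (powerSum-characteristic 1≤δ)
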